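{- It is not possible to code an infinite linear ordering in $\mathcal{E}$ without parameters, even on equivalence classes of tuples: there are no $n\ge1$ and parameter-free first-order formulas $\delta(\bar x)$, $\varepsilon(\bar x,\bar y)$, $\lambda(\bar x,\bar y)$ in the language of $\mathcal{E}$ (with $\bar x,\bar y$ $n$-tuples of variables) such that $\varepsilon$ defines an equivalence relation on $D=\{\bar X\in\mathcal{E}^n:\mathcal{E}\models\delta(\bar X)\}$, $\lambda$ defines on $D$ a relation compatible with this equivalence, and the induced structure on the quotient of $D$ is an infinite linear order.
   Context: $\mathcal{E}$ is the lattice of c.e. subsets of $\mathbb{N}$ under inclusion. -}

module Defs where

open import Data.Nat using (ℕ; zero; suc; _+_; _≤_)
open import Data.Fin using (Fin; splitAt)
import Data.Fin as F
open import Data.Vec using (Vec; []; _∷_; lookup)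
open import Data.List using (List)
open import Data.List.Relation.Unary.All using (All)
open import Data.List.Relation.Unary.Any using (Any)
open import Data.Product using (Σ; _×_)
open import Data.Sum using (_⊎_; [_,_])
open import Data.Empty using (⊥)
open import Relation.Nullary using (¬_)
open import Relation.Binary.PropositionalEquality using (_≢_)

data PR : ℕ → Set where
  zeroᵖ : ∀ {k} → PR k
  succᵖ : PR 1
  proj  : ∀ {k} → Fin k → PR k
  comp  : ∀ {m k} → PR m → Vec (PR k) m → PR k
  rec   : ∀ {k} → PR k → PR (suc (suc k)) → PR (suc k)

mutual
  eval : ∀ {k} → PR k → Vec ℕ k → ℕ
  eval zeroᵖ xs = 0
  eval succᵖ (x ∷ []) = suc x
  eval (proj i) xs = lookup xs i
  eval (comp f gs) xs = eval f (evalVec gs xs)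
  eval (rec f g) (zero ∷ xs) = eval f xs
  eval (rec f g) (suc n ∷ xs) = eval g (eval (rec f g) (n ∷ xs) ∷ n ∷ xs)

  evalVec : ∀ {m k} → Vec (PR k) m → Vec ℕ k → Vec ℕ m
  evalVec [] xs = []
  evalVec (g ∷ gs) xs = eval g xs ∷ evalVec gs xs

-- C.e. sets: a code e : PR 2 presents the Σ₁ set
--   W e = { x | ∃ t. eval e (x , t) ≠ 0 }   (Kleene normal form);
-- every c.e. set is of this form.  Membership is read classically (¬¬).

CE : Set
CE = PR 2

_∈W_ : ℕ → CE → Set
x ∈W e = ¬ ¬ Σ ℕ (λ t → eval e (x ∷ t ∷ []) ≢ 0)

_⊆W_ : CE → CE → Set
e ⊆W d = ∀ x → x ∈W e → x ∈W d

_≡W_ : CE → CE → Set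
e ≡W d = (e ⊆W d) × (d ⊆W e)

data Formula : ℕ → Set where
  _≤ᶠ_ : ∀ {k} → Fin k → Fin k → Formula k
  _≐_  : ∀ {k} → Fin k → Fin k → Formula k
  fls  : ∀ {k} → Formula k
  _∧ᶠ_ : ∀ {k} → Formula k → Formula k → Formula k
  _∨ᶠ_ : ∀ {k} → Formula k → Formula k → Formula k
  _⇒ᶠ_ : ∀ {k} → Formula k → Formula k → Formula k
  ∀ᶠ   : ∀ {k} → Formula (suc k) → Formula k
  ∃ᶠ   : ∀ {k} → Formula (suc k) → Formula k

extend : ∀ {k} → CE → (Fin k → CE) → Fin (suc k) → CE
extend e ρ F.zero = e
extend e ρ (F.suc i) = ρ i

-- Classical (double-negation) Tarski semantics in ℰ.
Sat : ∀ {k} → Formula k → (Fin k → CE) → Set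
Sat (i ≤ᶠ j) ρ = ρ i ⊆W ρ j
Sat (i ≐ j) ρ = ρ i ≡W ρ j
Sat fls ρ = ⊥
Sat (φ ∧ᶠ ψ) ρ = Sat φ ρ × Sat ψ ρ
Sat (φ ∨ᶠ ψ) ρ = ¬ ¬ (Sat φ ρ ⊎ Sat ψ ρ)
Sat (φ ⇒ᶠ ψ) ρ = Sat φ ρ → Sat ψ ρ
Sat (∀ᶠ φ) ρ = (e : CE) → Sat φ (extend e ρ)
Sat (∃ᶠ φ) ρ = ¬ ((e : CE) → ¬ Sat φ (extend e ρ))

Tuple : ℕ → Set
Tuple n = Fin n → CE

pair : ∀ {n} → Tuple n → Tuple n → Fin (n + n) → CE
pair {n} X Y i = [ X , Y ] (splitAt n i)

record InfLinOrderInterp (n : ℕ) (δ : Formula n) (ε ℓt : Formula (n + n)) : Set where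
  field
    ε-refl  : ∀ X → Sat δ X → Sat ε (pair X X)
    ε-sym   : ∀ X Y → Sat δ X → Sat δ Y → Sat ε (pair X Y) → Sat ε (pair Y X)
    ε-trans : ∀ X Y Z → Sat δ X → Sat δ Y → Sat δ Z →
              Sat ε (pair X Y) → Sat ε (pair Y Z) → Sat ε (pair X Z)
    λ-compat : ∀ X X' Y Y' → Sat δ X → Sat δ X' → Sat δ Y → Sat δ Y' →
               Sat ε (pair X X') → Sat ε (pair Y Y') →
               Sat ℓt (pair X Y) → Sat ℓt (pair X' Y')
    λ-refl    : ∀ X → Sat δ X → Sat ℓt (pair X X)
    λ-antisym : ∀ X Y → Sat δ X → Sat δ Y →
                Sat ℓt (pair X Y) → Sat ℓt (pair Y X) → Sat ε (pair X Y)
    λ-trans   : ∀ X Y Z → Sat δ X → Sat δ Y → Sat δ Z →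
                Sat ℓt (pair X Y) → Sat ℓt (pair Y Z) → Sat ℓt (pair X Z)
    λ-total   : ∀ X Y → Sat δ X → Sat δ Y →
                ¬ ¬ (Sat ℓt (pair X Y) ⊎ Sat ℓt (pair Y X))
    infinite  : ∀ (L : List (Tuple n)) → All (λ Y → Sat δ Y) L →
                ¬ (∀ X → Sat δ X → ¬ ¬ Any (λ Y → Sat ε (pair X Y)) L)

{-# OPTIONS --safe #-}
module Submission where

open import Defs
open import Data.Nat using (ℕ; zero; suc; pred; _+_; _*_; _∸_; _⊔_; _≤_; _<_; z≤n; s≤s; _≟_)
open import Data.Nat.Properties
open import Data.Fin using (Fin; splitAt; #_)
import Data.Fin as F
open import Data.Fin.Properties using (splitAt-↑ˡ)
open import Data.Vec using (Vec; []; _∷_; lookup; tabulate)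
open import Data.Vec.Properties using (tabulate∘lookup)
open import Data.List using (List; []; _∷_; _++_; map; allFin; cartesianProduct)
open import Data.List.Relation.Unary.All using (All; []; _∷_)
import Data.List.Relation.Unary.All as All
import Data.List.Relation.Unary.All.Properties as Allₚ
open import Data.List.Relation.Unary.Any using (Any; here; there)
import Data.List.Relation.Unary.Any as Any
import Data.List.Relation.Unary.Any.Properties as Anyₚ
open import Data.List.Membership.Propositional using (_∈_; find)
open import Data.List.Membership.Propositional.Properties
  using (∈-++⁺ˡ; ∈-++⁺ʳ; ∈-map⁺; ∈-allFin; ∈-cartesianProduct⁺)
open import Data.Product using (Σ; ∃; _×_; _,_; proj₁; proj₂; swap)
open import Data.Sum using (_⊎_; inj₁; inj₂; [_,_])
import Data.Sum as Sum
open import Data.Unit using (⊤)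
open import Data.Empty using (⊥; ⊥-elim)
open import Function using (_∘_; id; const)
open import Relation.Nullary using (¬_; Dec; yes; no; contradiction)
open import Relation.Nullary.Decidable.Core using (¬¬-excluded-middle)
open import Relation.Binary using (tri<; tri≈; tri>)
open import Relation.Binary.PropositionalEquality
  using (_≡_; _≢_; refl; sym; trans; cong; cong₂; subst)

-- An involution σ of ℰ induces an automorphism of finite order of the coded linear
-- order, hence the identity, so every X in D is equivalent to σ(X).  Fix a splitting of
-- ℕ into two infinite computable parts, giving ℰ ≅ ℰ × ℰ.  Every c.e. set contains, or
-- has disjoint from it, an infinite computable set with infinite complement; exchanging
-- such a set with the right part shows that every X in D is equivalent to some (A , c)
-- all of whose right halves are ∅ or ℕ.  Exchanging the parts, (A , c) is equivalent to
-- (c , A).  By Feferman–Vaught the truth of ε((A , c), (c , A)) depends on the right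
-- halves only through the type of (c , A) up to the quantifier depth of ε, so if A′ has
-- the same type as A then (A , c) is equivalent to (c , A′) and hence to (A′ , c).  As
-- there are finitely many types, D has finitely many classes.

-- Classical arguments run in the double-negation monad.

pure : ∀ {a} {A : Set a} → A → ¬ ¬ A
pure a k = k a

infixl 1 _>>=_
_>>=_ : ∀ {a b} {A : Set a} {B : Set b} → ¬ ¬ A → (A → ¬ ¬ B) → ¬ ¬ B
(m >>= f) k = m λ a → f a k

-- Inclusion and equality of c.e. sets

infix 4 _⊑_ _≈_

-- A record around `_⊆W_`, which would otherwise unfold and keep the two codes from being inferred.
record _⊑_ (e d : CE) : Set where
  constructor incl
  field at : e ⊆W d
open _⊑_

_≈_ : CE → CE → Set
e ≈ d = e ⊑ d × d ⊑ e

⊑-refl : ∀ {e} → e ⊑ e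
⊑-refl = incl λ _ x∈ → x∈

⊑-trans : ∀ {a b c} → a ⊑ b → b ⊑ c → a ⊑ c
⊑-trans p q = incl λ x x∈ → at q x (at p x x∈)

≈-refl : ∀ {e} → e ≈ e
≈-refl = ⊑-refl , ⊑-refl

≈-sym : ∀ {a b} → a ≈ b → b ≈ a
≈-sym = swap

≈-trans : ∀ {a b c} → a ≈ b → b ≈ c → a ≈ c
≈-trans (p , p′) (q , q′) = ⊑-trans p q , ⊑-trans q′ p′

⊑-resp : ∀ {a a′ b b′} → a ≈ a′ → b ≈ b′ → a ⊑ b → a′ ⊑ b′
⊑-resp (_ , p) (q , _) r = ⊑-trans p (⊑-trans r q)

-- Back-and-forth equivalence

SameOrder : ∀ {k} → Tuple k → Tuple k → Set
SameOrder A B = ∀ i j → (A i ⊑ A j → B i ⊑ B j) × (B i ⊑ B j → A i ⊑ A j)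

infix 4 _≅[_]_

-- The Ehrenfeucht-Fraïssé game with the given number of rounds. Comparing inclusions covers all
-- atomic formulas, equality being mutual inclusion.
_≅[_]_ : ∀ {k} → Tuple k → ℕ → Tuple k → Set
A ≅[ zero ] B = SameOrder A B
A ≅[ suc s ] B = SameOrder A B
  × (∀ e → ¬ ¬ (∃ λ d → extend e A ≅[ s ] extend d B))
  × (∀ d → ¬ ¬ (∃ λ e → extend e A ≅[ s ] extend d B))

≅⇒SameOrder : ∀ {k} s {A B : Tuple k} → A ≅[ s ] B → SameOrder A B
≅⇒SameOrder zero    p = p
≅⇒SameOrder (suc s) p = proj₁ p

≅-sym : ∀ {k} s {A B : Tuple k} → A ≅[ s ] B → B ≅[ s ] A
≅-sym zero p i j = swap (p i j)
≅-sym (suc s) (o , f , b) =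
  (λ i j → swap (o i j)) ,
  (λ e → b e >>= λ (d , p) → pure (d , ≅-sym s p)) ,
  (λ e → f e >>= λ (d , p) → pure (d , ≅-sym s p))

≅-trans : ∀ {k} s {A B C : Tuple k} → A ≅[ s ] B → B ≅[ s ] C → A ≅[ s ] C
≅-trans zero p q i j =
  proj₁ (q i j) ∘ proj₁ (p i j) , proj₂ (p i j) ∘ proj₂ (q i j)
≅-trans (suc s) (o , f , b) (o′ , f′ , b′) =
  (λ i j → proj₁ (o′ i j) ∘ proj₁ (o i j) , proj₂ (o i j) ∘ proj₂ (o′ i j)) ,
  (λ e → f e >>= λ (d , p) → f′ d >>= λ (c , q) → pure (c , ≅-trans s p q)) ,
  (λ c → b′ c >>= λ (d , q) → b d >>= λ (e , p) → pure (e , ≅-trans s p q))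

depth : ∀ {k} → Formula k → ℕ
depth (i ≤ᶠ j) = 0
depth (i ≐ j)  = 0
depth fls      = 0
depth (φ ∧ᶠ ψ) = depth φ ⊔ depth ψ
depth (φ ∨ᶠ ψ) = depth φ ⊔ depth ψ
depth (φ ⇒ᶠ ψ) = depth φ ⊔ depth ψ
depth (∀ᶠ φ)   = suc (depth φ)
depth (∃ᶠ φ)   = suc (depth φ)

-- Membership, disjunction and existence are read through negations, and the other connectives
-- preserve stability. This is how arguments in the monad end in plain truth.
Sat-stable : ∀ {k} (φ : Formula k) {A} → ¬ ¬ Sat φ A → Sat φ A
Sat-stable (i ≤ᶠ j) m x x∈ = m >>= λ p → p x x∈
Sat-stable (i ≐ j)  m = (λ x x∈ → m >>= λ p → proj₁ p x x∈)
                      , (λ x x∈ → m >>= λ p → proj₂ p x x∈)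
Sat-stable fls      m = m id
Sat-stable (φ ∧ᶠ ψ) m = Sat-stable φ (m >>= (pure ∘ proj₁))
                      , Sat-stable ψ (m >>= (pure ∘ proj₂))
Sat-stable (φ ∨ᶠ ψ) m = m >>= id
Sat-stable (φ ⇒ᶠ ψ) m p = Sat-stable ψ (m >>= λ f → pure (f p))
Sat-stable (∀ᶠ φ)   m e = Sat-stable φ (m >>= λ f → pure (f e))
Sat-stable (∃ᶠ φ)   m = λ k → m λ h → h k

-- Induction on `φ`: the back condition serves `∀ᶠ`, the forth condition `∃ᶠ`, and symmetry carries
-- the premise of an implication back to `A`.
≅⇒Sat : ∀ {k} (φ : Formula k) {s} → depth φ ≤ s →
        ∀ {A B} → A ≅[ s ] B → Sat φ A → Sat φ B
≅⇒Sat (i ≤ᶠ j) {s} _ {A} {B} p h =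
  at (proj₁ (≅⇒SameOrder s {A} {B} p i j) (incl h))
≅⇒Sat (i ≐ j) {s} _ {A} {B} p (h , h′) =
  at (proj₁ (≅⇒SameOrder s {A} {B} p i j) (incl h)) ,
  at (proj₁ (≅⇒SameOrder s {A} {B} p j i) (incl h′))
≅⇒Sat (φ ∧ᶠ ψ) le p (h , h′) =
  ≅⇒Sat φ (m⊔n≤o⇒m≤o _ _ le) p h , ≅⇒Sat ψ (m⊔n≤o⇒n≤o (depth φ) _ le) p h′
≅⇒Sat (φ ∨ᶠ ψ) le p h = h >>= λ where
  (inj₁ x) → pure (inj₁ (≅⇒Sat φ (m⊔n≤o⇒m≤o _ _ le) p x))
  (inj₂ y) → pure (inj₂ (≅⇒Sat ψ (m⊔n≤o⇒n≤o (depth φ) _ le) p y))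
≅⇒Sat (φ ⇒ᶠ ψ) {s} le p h x =
  ≅⇒Sat ψ (m⊔n≤o⇒n≤o (depth φ) _ le) p
    (h (≅⇒Sat φ (m⊔n≤o⇒m≤o _ _ le) (≅-sym s p) x))
≅⇒Sat (∀ᶠ φ) (s≤s le) (_ , _ , b) h d =
  Sat-stable φ (b d >>= λ (e , p) → pure (≅⇒Sat φ le p (h e)))
≅⇒Sat (∃ᶠ φ) (s≤s le) (_ , f , _) h k =
  h λ e x → f e λ (d , p) → k d (≅⇒Sat φ le p x)

-- Finiteness of the number of types

any-with : ∀ {A : Set} {P Q R : A → Set} {xs} →
           (∀ {x} → P x → Q x → R x) → All P xs → Any Q xs → Any R xs
any-with f (p ∷ _)  (here q)  = here (f p q)
any-with f (_ ∷ ps) (there a) = there (any-with f ps a)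

-- Each predicate cuts `Q` in two, and representatives of both pieces are listed. With no predicate
-- left, one element of `Q` stands for all, unless `Q` is empty.
finite-reps : ∀ {I T : Set} (R : I → T → Set) (is : List I) (Q : T → Set) →
  ¬ ¬ (Σ (List T) λ L → All Q L × (∀ A → Q A →
    ¬ ¬ Any (λ B → ∀ {i} → i ∈ is → (R i A → R i B) × (R i B → R i A)) L))
finite-reps {T = T} R [] Q = ¬¬-excluded-middle {A = Σ T Q} >>= λ where
  (yes (A , q)) → pure (A ∷ [] , q ∷ [] , λ _ _ → pure (here λ ()))
  (no ¬q)       → pure ([] , [] , λ A q → ⊥-elim (¬q (A , q)))
finite-reps R (i ∷ is) Q =
  finite-reps R is (λ A → Q A × R i A) >>= λ (L , all , rep) →
  finite-reps R is (λ A → Q A × ¬ R i A) >>= λ (L′ , all′ , rep′) →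
  pure (L ++ L′ , Allₚ.++⁺ (All.map proj₁ all) (All.map proj₁ all′) , λ A q →
    ¬¬-excluded-middle {A = R i A} >>= λ where
      (yes r) → rep A (q , r) >>= λ any → pure (Anyₚ.++⁺ˡ
        (any-with (λ { (_ , r′) agree (here refl) → const r′ , const r
                     ; _ agree (there j) → agree j }) all any))
      (no ¬r) → rep′ A (q , ¬r) >>= λ any → pure (Anyₚ.++⁺ʳ L
        (any-with (λ { (_ , ¬r′) agree (here refl) →
                         (λ r → ⊥-elim (¬r r)) , (λ r → ⊥-elim (¬r′ r))
                     ; _ agree (there j) → agree j }) all′ any)))

-- Induction on `s` with `k` varying: the type of a tuple at `suc s` is fixed by its order and by
-- which of the finitely many types of longer tuples at `s` its extensions realise.
finite-types : ∀ s k → ¬ ¬ (Σ (List (Tuple k)) λ L → ∀ A → ¬ ¬ Any (A ≅[ s ]_) L)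
finite-types s k = classes s >>= λ (I , is , R , same) →
  finite-reps R is (λ _ → ⊤) >>= λ (L , _ , rep) →
  pure (L , λ A → rep A _ >>= λ any → pure (Any.map (λ {B} → same A B) any))
  where
  Classifier : ℕ → Set₁
  Classifier s = Σ Set λ I → Σ (List I) λ is → Σ (I → Tuple k → Set) λ R →
    ∀ A B → (∀ {i} → i ∈ is → (R i A → R i B) × (R i B → R i A)) → A ≅[ s ] B

  pairs : List (Fin k × Fin k)
  pairs = cartesianProduct (allFin k) (allFin k)

  pair∈ : ∀ i j → (i , j) ∈ pairs
  pair∈ i j = ∈-cartesianProduct⁺ (∈-allFin i) (∈-allFin j)

  classes : ∀ s → ¬ ¬ Classifier s
  classes zero = pure ((Fin k × Fin k) , pairs , (λ (i , j) A → A i ⊑ A j) ,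
    λ A B agree i j → agree (pair∈ i j))
  classes (suc s) = finite-types s (suc k) >>= λ (L , rep) →
    pure (((Fin k × Fin k) ⊎ Tuple (suc k)) , map inj₁ pairs ++ map inj₂ L ,
      (λ where (inj₁ (i , j)) A → A i ⊑ A j
               (inj₂ C) A → ¬ ¬ Reaches A C) ,
      λ A B agree →
        let reach∈ = λ {C} (C∈ : C ∈ L) → ∈-++⁺ʳ (map inj₁ pairs) (∈-map⁺ inj₂ C∈) in
        (λ i j → agree (∈-++⁺ˡ (∈-map⁺ inj₁ (pair∈ i j)))) ,
        match rep (λ C∈ → proj₁ (agree (reach∈ C∈))) ,
        λ d → match rep (λ C∈ → proj₂ (agree (reach∈ C∈))) d >>= λ (e , p) →
          pure (e , ≅-sym s p))
    where
    Reaches : Tuple k → Tuple (suc k) → Set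
    Reaches A C = ∃ λ e → extend e A ≅[ s ] C

    match : ∀ {L A B} → (∀ A → ¬ ¬ Any (A ≅[ s ]_) L) →
            (∀ {C} → C ∈ L → ¬ ¬ Reaches A C → ¬ ¬ Reaches B C) →
            ∀ e → ¬ ¬ (∃ λ d → extend e A ≅[ s ] extend d B)
    -- The listed type of `extend e A` is reached from `A`, hence from `B`; the extension of `B`
    -- that reaches it answers `e`.
    match {A = A} rep to e = rep (extend e A) >>= λ any →
      let _ , C∈ , p = find any in
      to C∈ (pure (e , p)) >>= λ (d , q) → pure (d , ≅-trans s p (≅-sym s q))

-- Involutions and splittings of the lattice

record Involution (σ : CE → CE) : Set where
  field
    mono  : ∀ {e d} → e ⊑ d → σ e ⊑ σ d
    invol : ∀ e → σ (σ e) ≈ e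

  SameOrder-image : ∀ {k} {A B : Tuple k} → (∀ i → B i ≈ σ (A i)) → SameOrder A B
  SameOrder-image {A = A} h i j =
    (λ p → ⊑-resp (≈-sym (h i)) (≈-sym (h j)) (mono p)) ,
    (λ p → ⊑-resp (invol (A i)) (invol (A j)) (mono (⊑-resp (h i) (h j) p)))

  -- A move on either side is answered by its image under `σ`, which is its own inverse.
  ≅-image : ∀ s {k} {A B : Tuple k} → (∀ i → B i ≈ σ (A i)) → A ≅[ s ] B
  ≅-image zero h = SameOrder-image h
  ≅-image (suc s) h = SameOrder-image h ,
    (λ e → pure (σ e , ≅-image s λ { F.zero → ≈-refl ; (F.suc i) → h i })) ,
    (λ d → pure (σ d , ≅-image s λ { F.zero → ≈-sym (invol d) ; (F.suc i) → h i }))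

-- An isomorphism of the lattice with its square.
record Split : Set where
  field
    left right : CE → CE
    join       : CE → CE → CE
    left-mono  : ∀ {e d} → e ⊑ d → left e ⊑ left d
    right-mono : ∀ {e d} → e ⊑ d → right e ⊑ right d
    join-mono  : ∀ {a b c d} → a ⊑ b → c ⊑ d → join a c ⊑ join b d
    left-join  : ∀ a b → left (join a b) ≈ a
    right-join : ∀ a b → right (join a b) ≈ b
    join-η     : ∀ e → join (left e) (right e) ≈ e

  left-cong : ∀ {e d} → e ≈ d → left e ≈ left d
  left-cong (p , q) = left-mono p , left-mono q

  right-cong : ∀ {e d} → e ≈ d → right e ≈ right d
  right-cong (p , q) = right-mono p , right-mono q

  join-cong : ∀ {a b c d} → a ≈ b → c ≈ d → join a c ≈ join b d
  join-cong (p , p′) (q , q′) = join-mono p q , join-mono p′ q′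

  reflect : ∀ {e d} → left e ⊑ left d → right e ⊑ right d → e ⊑ d
  reflect p q = ⊑-resp (join-η _) (join-η _) (join-mono p q)

  SameOrder-join : ∀ {k m} {A B : Tuple k} {A′ B′ : Tuple m} (ρ : Fin k → Fin m) →
           (∀ i → left (A i) ≈ left (B i)) →
           (∀ i → right (A i) ≈ A′ (ρ i)) → (∀ i → right (B i) ≈ B′ (ρ i)) →
           SameOrder A′ B′ → SameOrder A B
  SameOrder-join ρ l rA rB p i j =
    (λ h → reflect (⊑-resp (l i) (l j) (left-mono h))
      (⊑-resp (≈-sym (rB i)) (≈-sym (rB j))
        (proj₁ (p (ρ i) (ρ j)) (⊑-resp (rA i) (rA j) (right-mono h))))) ,
    (λ h → reflect (⊑-resp (≈-sym (l i)) (≈-sym (l j)) (left-mono h))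
      (⊑-resp (≈-sym (rA i)) (≈-sym (rA j))
        (proj₂ (p (ρ i) (ρ j)) (⊑-resp (rB i) (rB j) (right-mono h)))))

  -- Feferman–Vaught for the product: the types of the two halves determine the
  -- type of the whole.  The right halves may be read off larger tuples along ρ.
  ≅-join : ∀ s {k m} {A B : Tuple k} {A′ B′ : Tuple m} (ρ : Fin k → Fin m) →
           (∀ i → left (A i) ≈ left (B i)) →
           (∀ i → right (A i) ≈ A′ (ρ i)) → (∀ i → right (B i) ≈ B′ (ρ i)) →
           A′ ≅[ s ] B′ → A ≅[ s ] B
  ≅-join zero = SameOrder-join
  ≅-join (suc s) ρ l rA rB (o , f , b) =
    SameOrder-join ρ l rA rB o ,
    -- The answer copies the left half of the move and takes its right half from the game on `A′`
    -- and `B′`.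
    (λ e → f (right e) >>= λ (d , p) → pure (join (left e) d ,
      ≅-join s (F.lift 1 ρ)
        (λ { F.zero → ≈-sym (left-join _ _) ; (F.suc i) → l i })
        (λ { F.zero → ≈-refl ; (F.suc i) → rA i })
        (λ { F.zero → right-join _ _ ; (F.suc i) → rB i }) p)) ,
    (λ e → b (right e) >>= λ (d , p) → pure (join (left e) d ,
      ≅-join s (F.lift 1 ρ)
        (λ { F.zero → left-join _ _ ; (F.suc i) → l i })
        (λ { F.zero → right-join _ _ ; (F.suc i) → rA i })
        (λ { F.zero → ≈-refl ; (F.suc i) → rB i }) p))

  exchange : CE → CE
  exchange e = join (right e) (left e)

  left-exchange : ∀ e → left (exchange e) ≈ right e
  left-exchange e = left-join _ _

  right-exchange : ∀ e → right (exchange e) ≈ left e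
  right-exchange e = right-join _ _

  exchange-involution : Involution exchange
  exchange-involution = record
    { mono  = λ p → join-mono (right-mono p) (left-mono p)
    ; invol = λ e → ≈-trans (join-cong (right-exchange e) (left-exchange e)) (join-η e)
    }

-- `T` divides the right part of `S`. Only its right piece stays on the right; the other piece is
-- merged with the left part by reusing `S.join` as a pairing.
refine : Split → Split → Split
refine S T = record
  { left       = λ e → S.join (S.left e) (T.left (S.right e))
  ; right      = λ e → T.right (S.right e)
  ; join       = λ a b → S.join (S.left a) (T.join (S.right a) b)
  ; left-mono  = λ p → S.join-mono (S.left-mono p) (T.left-mono (S.right-mono p))
  ; right-mono = λ p → T.right-mono (S.right-mono p)
  ; join-mono  = λ p q → S.join-mono (S.left-mono p) (T.join-mono (S.right-mono p) q)
  ; left-join  = λ a b → ≈-trans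
      (S.join-cong (S.left-join _ _)
        (≈-trans (T.left-cong (S.right-join _ _)) (T.left-join _ _)))
      (S.join-η a)
  ; right-join = λ a b → ≈-trans (T.right-cong (S.right-join _ _)) (T.right-join _ _)
  ; join-η     = λ e → ≈-trans
      (S.join-cong (S.left-join _ _)
        (≈-trans (T.join-cong (S.right-join _ _) ≈-refl) (T.join-η _)))
      (S.join-η e)
  }
  where module S = Split S
        module T = Split T

-- For N = L ⊔ R and L = L₀ ⊔ L₁, the involution exchanging L₁ and R.
module Transposition (S T : Split) where
  private module S = Split S
          module T = Split T

  transpose : CE → CE
  transpose e = S.join (T.join (T.left (S.left e)) (S.right e)) (T.right (S.left e))

  right-transpose : ∀ e → S.right (transpose e) ≈ T.right (S.left e)
  right-transpose e = S.right-join _ _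

  transpose-involution : Involution transpose
  transpose-involution = record
    { mono  = λ p → S.join-mono
        (T.join-mono (T.left-mono (S.left-mono p)) (S.right-mono p))
        (T.right-mono (S.left-mono p))
    ; invol = λ e → ≈-trans
        (S.join-cong
          (≈-trans
            (T.join-cong
              (≈-trans (T.left-cong (S.left-join _ _)) (T.left-join _ _))
              (S.right-join _ _))
            (T.join-η _))
          (≈-trans (T.right-cong (S.left-join _ _)) (T.right-join _ _)))
        (S.join-η e)
    }

-- Constancy on one half

∅ᶜ : CE
∅ᶜ = zeroᵖ

ℕᶜ : CE
ℕᶜ = comp succᵖ (zeroᵖ ∷ [])

∅-least : ∀ {e} → ∅ᶜ ⊑ e
∅-least = incl λ x x∈ → ⊥-elim (x∈ λ (_ , 0≢0) → 0≢0 refl)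

ℕ-greatest : ∀ {e} → e ⊑ ℕᶜ
ℕ-greatest = incl λ x _ → pure (0 , λ ())

Trivial : CE → Set
Trivial e = e ⊑ ∅ᶜ ⊎ ℕᶜ ⊑ e

module _ (S : Split) where
  open Split S

  -- ∅ lies below `join ∅ᶜ ∅ᶜ`, whose right half is ∅; dually for ℕ.
  right-trivial : ∀ {e} → Trivial e → Trivial (right e)
  right-trivial (inj₁ p) =
    inj₁ (⊑-trans (right-mono (⊑-trans p ∅-least)) (proj₁ (right-join ∅ᶜ ∅ᶜ)))
  right-trivial (inj₂ p) =
    inj₂ (⊑-trans (proj₂ (right-join ℕᶜ ℕᶜ)) (right-mono (⊑-trans ℕ-greatest p)))

Trivial-resp : ∀ {e d} → e ≈ d → Trivial e → Trivial d
Trivial-resp (p , q) (inj₁ t) = inj₁ (⊑-trans q t)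
Trivial-resp (p , q) (inj₂ t) = inj₂ (⊑-trans t p)

-- Primitive recursive terms

num : ∀ {k} → ℕ → PR k
num zero    = zeroᵖ
num (suc n) = comp succᵖ (num n ∷ [])

eval-num : ∀ {k} n (xs : Vec ℕ k) → eval (num n) xs ≡ n
eval-num zero    xs = refl
eval-num (suc n) xs = cong suc (eval-num n xs)

infixl 6 _⊕_ _⊖_
infixl 7 _⊗_

addᵖ : PR 2
addᵖ = rec (proj (# 0)) (comp succᵖ (proj (# 0) ∷ []))

_⊕_ : ∀ {k} → PR k → PR k → PR k
a ⊕ b = comp addᵖ (a ∷ b ∷ [])

eval-add : ∀ m n → eval addᵖ (m ∷ n ∷ []) ≡ m + n
eval-add zero    n = refl
eval-add (suc m) n = cong suc (eval-add m n)

eval-⊕ : ∀ {k} (a b : PR k) xs → eval (a ⊕ b) xs ≡ eval a xs + eval b xs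
eval-⊕ a b xs = eval-add (eval a xs) (eval b xs)

mulᵖ : PR 2
mulᵖ = rec zeroᵖ (proj (# 2) ⊕ proj (# 0))

_⊗_ : ∀ {k} → PR k → PR k → PR k
a ⊗ b = comp mulᵖ (a ∷ b ∷ [])

eval-mul : ∀ m n → eval mulᵖ (m ∷ n ∷ []) ≡ m * n
eval-mul zero    n = refl
eval-mul (suc m) n = trans (eval-add n _) (cong (n +_) (eval-mul m n))

eval-⊗ : ∀ {k} (a b : PR k) xs → eval (a ⊗ b) xs ≡ eval a xs * eval b xs
eval-⊗ a b xs = eval-mul (eval a xs) (eval b xs)

-- The recursion is on the subtrahend, which therefore comes first.
monusᵖ : PR 2
monusᵖ = rec (proj (# 0)) (comp (rec zeroᵖ (proj (# 1))) (proj (# 0) ∷ []))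

_⊖_ : ∀ {k} → PR k → PR k → PR k
a ⊖ b = comp monusᵖ (b ∷ a ∷ [])

eval-monus : ∀ m n → eval monusᵖ (n ∷ m ∷ []) ≡ m ∸ n
eval-monus m zero    = refl
eval-monus m (suc n) = trans (predᵖ (eval monusᵖ (n ∷ m ∷ [])))
  (trans (cong pred (eval-monus m n)) (pred[m∸n]≡m∸[1+n] m n))
  where
  predᵖ : ∀ m → eval (rec zeroᵖ (proj (# 1))) (m ∷ []) ≡ pred m
  predᵖ zero    = refl
  predᵖ (suc m) = refl

eval-⊖ : ∀ {k} (a b : PR k) xs → eval (a ⊖ b) xs ≡ eval a xs ∸ eval b xs
eval-⊖ a b xs = eval-monus (eval a xs) (eval b xs)

ifzero : ∀ {k} → PR k → PR k → PR k → PR k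
-- In the successor case the arguments are the previous value, the predecessor, `a` and `b`.
ifzero c a b = comp (rec (proj (# 0)) (proj (# 3))) (c ∷ a ∷ b ∷ [])

ifzero-≡0 : ∀ {k} (c a b : PR k) xs → eval c xs ≡ 0 → eval (ifzero c a b) xs ≡ eval a xs
ifzero-≡0 c a b xs p rewrite p = refl

ifzero-≢0 : ∀ {k} (c a b : PR k) xs → eval c xs ≢ 0 → eval (ifzero c a b) xs ≡ eval b xs
ifzero-≢0 c a b xs p with eval c xs
... | zero  = contradiction refl p
... | suc _ = refl

∑ : ℕ → (ℕ → ℕ) → ℕ
∑ zero    f = 0
∑ (suc n) f = f n + ∑ n f

sumᵖ : ∀ {k} → PR (suc k) → PR (suc k)
sumᵖ f = rec zeroᵖ (comp f (proj (# 1) ∷ tabulate (λ i → proj (F.suc (F.suc i)))) ⊕ proj (# 0))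

∑ᵖ : ∀ {k} → PR k → PR (suc k) → PR k
∑ᵖ b f = comp (sumᵖ f) (b ∷ tabulate proj)

evalVec-proj : ∀ {m k} (ρ : Fin m → Fin k) xs →
               evalVec (tabulate (λ i → proj (ρ i))) xs ≡ tabulate (λ i → lookup xs (ρ i))
evalVec-proj {zero}  ρ xs = refl
evalVec-proj {suc m} ρ xs = cong (lookup xs (ρ F.zero) ∷_) (evalVec-proj (ρ ∘ F.suc) xs)

eval-sum : ∀ {k} (f : PR (suc k)) n xs → eval (sumᵖ f) (n ∷ xs) ≡ ∑ n (λ y → eval f (y ∷ xs))
eval-sum f zero    xs = refl
eval-sum f (suc n) xs = trans (eval-add (eval f (n ∷ _)) _)
  (cong₂ (λ ys s → eval f (n ∷ ys) + s)
    (trans (evalVec-proj _ (eval (sumᵖ f) (n ∷ xs) ∷ n ∷ xs)) (tabulate∘lookup xs))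
    (eval-sum f n xs))

eval-∑ : ∀ {k} (b : PR k) f xs → eval (∑ᵖ b f) xs ≡ ∑ (eval b xs) (λ y → eval f (y ∷ xs))
eval-∑ b f xs = trans
  (cong (λ ys → eval (sumᵖ f) (eval b xs ∷ ys)) (trans (evalVec-proj id xs) (tabulate∘lookup xs)))
  (eval-sum f (eval b xs) xs)

-- Nonzero values as truth

∑≢0⁺ : ∀ {n f y} → y < n → f y ≢ 0 → ∑ n f ≢ 0
∑≢0⁺ {suc n} {f} {y} (s≤s y≤n) p q with m≤n⇒m<n∨m≡n y≤n
... | inj₁ y<n  = ∑≢0⁺ y<n p (m+n≡0⇒n≡0 (f n) q)
... | inj₂ refl = p (m+n≡0⇒m≡0 (f n) q)

∑≢0⁻ : ∀ n {f} → ∑ n f ≢ 0 → ∃ λ y → y < n × f y ≢ 0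
∑≢0⁻ zero    p = contradiction refl p
∑≢0⁻ (suc n) {f} p with f n ≟ 0
... | no fn≢0  = n , ≤-refl , fn≢0
... | yes fn≡0 = let y , y<n , q = ∑≢0⁻ n (λ q → p (cong₂ _+_ fn≡0 q))
                 in y , m<n⇒m<1+n y<n , q

-- A record, so that the term and the arguments can be inferred.
record Holds {k} (a : PR k) (xs : Vec ℕ k) : Set where
  constructor holds
  field nonzero : eval a xs ≢ 0
open Holds

not : ∀ {k} → PR k → PR k
not a = ifzero a (num 1) (num 0)

infix 5 _==_

_==_ : ∀ {k} → PR k → PR k → PR k
a == b = not ((a ⊖ b) ⊕ (b ⊖ a))

-- Sums act as disjunctions, products as conjunctions, `∑ᵖ` as bounded existence and `⊖` as strict
-- comparison.
module _ {k : ℕ} {xs : Vec ℕ k} where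

  ⊕⁺ˡ : ∀ {a b} → Holds a xs → Holds (a ⊕ b) xs
  ⊕⁺ˡ {a} {b} (holds p) = holds λ q → p (m+n≡0⇒m≡0 _ (trans (sym (eval-⊕ a b xs)) q))

  ⊕⁺ʳ : ∀ {a b} → Holds b xs → Holds (a ⊕ b) xs
  ⊕⁺ʳ {a} {b} (holds p) = holds λ q → p (m+n≡0⇒n≡0 (eval a xs) (trans (sym (eval-⊕ a b xs)) q))

  ⊕⁻ : ∀ {a b} → Holds (a ⊕ b) xs → Holds a xs ⊎ Holds b xs
  ⊕⁻ {a} {b} (holds p) with eval a xs ≟ 0
  ... | no a≢0  = inj₁ (holds a≢0)
  ... | yes a≡0 = inj₂ (holds λ b≡0 → p (trans (eval-⊕ a b xs) (cong₂ _+_ a≡0 b≡0)))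

  ⊗⁺ : ∀ {a b} → Holds a xs → Holds b xs → Holds (a ⊗ b) xs
  ⊗⁺ {a} {b} (holds p) (holds q) =
    holds λ r → [ p , q ] (m*n≡0⇒m≡0∨n≡0 _ (trans (sym (eval-⊗ a b xs)) r))

  ⊗⁻ : ∀ {a b} → Holds (a ⊗ b) xs → Holds a xs × Holds b xs
  ⊗⁻ {a} {b} (holds p) =
    holds (λ a≡0 → p (trans (eval-⊗ a b xs) (cong (_* eval b xs) a≡0))) ,
    holds (λ b≡0 → p (trans (eval-⊗ a b xs)
                            (trans (cong (eval a xs *_) b≡0) (*-zeroʳ (eval a xs)))))

  ∑⁺ : ∀ {b f y} → y < eval b xs → Holds f (y ∷ xs) → Holds (∑ᵖ b f) xs
  ∑⁺ {b} {f} y<b (holds p) =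
    holds λ q → ∑≢0⁺ {f = λ y → eval f (y ∷ xs)} y<b p (trans (sym (eval-∑ b f xs)) q)

  ∑⁻ : ∀ {b f} → Holds (∑ᵖ b f) xs → ∃ λ y → y < eval b xs × Holds f (y ∷ xs)
  ∑⁻ {b} {f} (holds p) =
    let y , y<b , q = ∑≢0⁻ (eval b xs) {λ y → eval f (y ∷ xs)}
                        (λ q → p (trans (eval-∑ b f xs) q))
    in y , y<b , holds q

  ⊖⁺ : ∀ {a b} → eval b xs < eval a xs → Holds (a ⊖ b) xs
  ⊖⁺ {a} {b} p = holds λ q → m>n⇒m∸n≢0 p (trans (sym (eval-⊖ a b xs)) q)

  ⊖⁻ : ∀ {a b} → Holds (a ⊖ b) xs → eval b xs < eval a xs
  ⊖⁻ {a} {b} (holds p) = ≰⇒> λ a≤b → p (trans (eval-⊖ a b xs) (m≤n⇒m∸n≡0 a≤b))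

  not⁺ : ∀ {a} → ¬ Holds a xs → Holds (not a) xs
  not⁺ {a} p with eval a xs ≟ 0
  ... | no a≢0  = contradiction (holds a≢0) p
  ... | yes a≡0 = holds λ q → 1+n≢0 (trans (sym (ifzero-≡0 a (num 1) (num 0) xs a≡0)) q)

  not⁻ : ∀ {a} → Holds (not a) xs → ¬ Holds a xs
  not⁻ {a} (holds p) (holds a≢0) = p (ifzero-≢0 a (num 1) (num 0) xs a≢0)

  ==⁺ : ∀ {a b} → eval a xs ≡ eval b xs → Holds (a == b) xs
  ==⁺ {a} {b} p = not⁺ λ q →
    [ (λ r → <-irrefl (sym p) (⊖⁻ r)) , (λ r → <-irrefl p (⊖⁻ r)) ] (⊕⁻ q)

  ==⁻ : ∀ {a b} → Holds (a == b) xs → eval a xs ≡ eval b xs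
  ==⁻ p = ≤-antisym
    (≮⇒≥ λ b<a → not⁻ p (⊕⁺ˡ (⊖⁺ b<a)))
    (≮⇒≥ λ a<b → not⁻ p (⊕⁺ʳ (⊖⁺ a<b)))

-- Images and preimages under Σ₁ relations

infix 4 _∈ᶜ_

record _∈ᶜ_ (x : ℕ) (e : CE) : Set where
  constructor member
  field witness : ¬ ¬ (∃ λ t → Holds e (x ∷ t ∷ []))
open _∈ᶜ_

∈-stable : ∀ {x e} → ¬ ¬ (x ∈ᶜ e) → x ∈ᶜ e
∈-stable m = member (m >>= witness)

∈⇒∈W : ∀ {x e} → x ∈ᶜ e → x ∈W e
∈⇒∈W (member m) = m >>= λ (t , p) → pure (t , nonzero p)

∈W⇒∈ : ∀ {x e} → x ∈W e → x ∈ᶜ e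
∈W⇒∈ m = member (m >>= λ (t , p) → pure (t , holds p))

⊑⁺ : ∀ {e d} → (∀ {x} → x ∈ᶜ e → ¬ ¬ (x ∈ᶜ d)) → e ⊑ d
⊑⁺ h = incl λ x x∈ → ∈⇒∈W (∈-stable (h (∈W⇒∈ x∈)))

⊑⁻ : ∀ {e d} → e ⊑ d → ∀ {x} → x ∈ᶜ e → x ∈ᶜ d
⊑⁻ p x∈ = ∈W⇒∈ (_⊑_.at p _ (∈⇒∈W x∈))

∈-∪ˡ : ∀ {d e x} → x ∈ᶜ d → x ∈ᶜ (d ⊕ e)
∈-∪ˡ (member m) = member (m >>= λ (t , p) → pure (t , ⊕⁺ˡ p))

∈-∪ʳ : ∀ {d e x} → x ∈ᶜ e → x ∈ᶜ (d ⊕ e)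
∈-∪ʳ (member m) = member (m >>= λ (t , p) → pure (t , ⊕⁺ʳ p))

∈-∪⁻ : ∀ {d e x} → x ∈ᶜ (d ⊕ e) → ¬ ¬ (x ∈ᶜ d ⊎ x ∈ᶜ e)
∈-∪⁻ (member m) = m >>= λ (t , p) →
  pure (Sum.map (λ q → member (pure (t , q))) (λ q → member (pure (t , q))) (⊕⁻ p))

Rel : PR 3 → ℕ → ℕ → Set
Rel g x y = ∃ λ t → Holds g (x ∷ y ∷ t ∷ [])

converse : PR 3 → PR 3
converse g = comp g (proj (# 1) ∷ proj (# 0) ∷ proj (# 2) ∷ [])

Rel-converse : ∀ {g x y} → Rel g x y → Rel (converse g) y x
Rel-converse (t , holds p) = t , holds p

Rel-converse⁻ : ∀ {g x y} → Rel (converse g) y x → Rel g x y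
Rel-converse⁻ (t , holds p) = t , holds p

-- { x | ∃ y. Rel g x y, y ∈ᶜ e }, with one bound for all three existential quantifiers
preimage : PR 3 → CE → CE
preimage g e = ∑ᵖ (proj (# 1))
  (∑ᵖ (proj (# 2)) (comp g (proj (# 2) ∷ proj (# 1) ∷ proj (# 0) ∷ [])) ⊗
   ∑ᵖ (proj (# 2)) (comp e (proj (# 1) ∷ proj (# 0) ∷ [])))

∈-preimage⁺ : ∀ {g e x y} → Rel g x y → y ∈ᶜ e → x ∈ᶜ preimage g e
∈-preimage⁺ {x = x} {y} (t , holds p) (member m) = member (m >>= λ (s , holds q) →
  pure (suc (y + t + s) ,
    ∑⁺ (s≤s (≤-trans (m≤m+n y t) (m≤m+n (y + t) s)))
      (⊗⁺ (∑⁺ (s≤s (≤-trans (m≤n+m t y) (m≤m+n (y + t) s))) (holds p))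
          (∑⁺ (s≤s (m≤n+m s (y + t))) (holds q)))))

∈-preimage⁻ : ∀ {g e x} → x ∈ᶜ preimage g e → ¬ ¬ (∃ λ y → Rel g x y × y ∈ᶜ e)
∈-preimage⁻ {x = x} (member m) = m >>= λ (u , p) →
  let y , _ , q = ∑⁻ p
      q₁ , q₂   = ⊗⁻ q
      t , _ , r = ∑⁻ q₁
      s , _ , w = ∑⁻ q₂
  in pure (y , (t , holds (nonzero r)) , member (pure (s , holds (nonzero w))))

record IsInjection (G : ℕ → ℕ → Set) : Set where
  field
    total      : ∀ i → ¬ ¬ (∃ λ y → G i y)
    functional : ∀ {i y y′} → G i y → G i y′ → y ≡ y′
    injective  : ∀ {i i′ y} → G i y → G i′ y → i ≡ i′

-- Two injections with Σ₁ graphs whose ranges partition ℕ. Halves are preimages, and `join` unites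
-- the images, which are preimages under the converse graphs. Injectivity and disjointness recover
-- the halves of a join; functionality and covering recover a set from its halves.
module FromPartition (g₀ g₁ : PR 3)
  (inj₀ : IsInjection (Rel g₀)) (inj₁′ : IsInjection (Rel g₁))
  (disjoint : ∀ {i i′ y} → Rel g₀ i y → Rel g₁ i′ y → ⊥)
  (cover : ∀ y → ¬ ¬ ((∃ λ i → Rel g₀ i y) ⊎ (∃ λ i → Rel g₁ i y)))
  where
  private
    module I₀ = IsInjection inj₀
    module I₁ = IsInjection inj₁′

    join : CE → CE → CE
    join a b = preimage (converse g₀) a ⊕ preimage (converse g₁) b

    ∈-joinˡ : ∀ {a b i y} → Rel g₀ i y → i ∈ᶜ a → y ∈ᶜ join a b
    ∈-joinˡ r i∈ = ∈-∪ˡ (∈-preimage⁺ (Rel-converse r) i∈)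

    ∈-joinʳ : ∀ {a b i y} → Rel g₁ i y → i ∈ᶜ b → y ∈ᶜ join a b
    ∈-joinʳ r i∈ = ∈-∪ʳ (∈-preimage⁺ (Rel-converse r) i∈)

    ∈-join⁻ : ∀ {a b y} → y ∈ᶜ join a b →
              ¬ ¬ ((∃ λ i → Rel g₀ i y × i ∈ᶜ a) ⊎ (∃ λ i → Rel g₁ i y × i ∈ᶜ b))
    ∈-join⁻ y∈ = ∈-∪⁻ y∈ >>= λ where
      (inj₁ p) → ∈-preimage⁻ p >>= λ (i , r , i∈) → pure (inj₁ (i , Rel-converse⁻ r , i∈))
      (inj₂ p) → ∈-preimage⁻ p >>= λ (i , r , i∈) → pure (inj₂ (i , Rel-converse⁻ r , i∈))

    preimage-mono : ∀ g {e d} → e ⊑ d → preimage g e ⊑ preimage g d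
    preimage-mono g p = ⊑⁺ λ x∈ → ∈-preimage⁻ x∈ >>= λ (y , r , y∈) →
      pure (∈-preimage⁺ r (⊑⁻ p y∈))

  split : Split
  split = record
    { left       = preimage g₀
    ; right      = preimage g₁
    ; join       = join
    ; left-mono  = preimage-mono g₀
    ; right-mono = preimage-mono g₁
    ; join-mono  = λ p q → ⊑⁺ λ y∈ → ∈-join⁻ y∈ >>= λ where
        (inj₁ (i , r , i∈)) → pure (∈-joinˡ r (⊑⁻ p i∈))
        (inj₂ (i , r , i∈)) → pure (∈-joinʳ r (⊑⁻ q i∈))
    ; left-join  = λ a b →
        (⊑⁺ λ i∈ → ∈-preimage⁻ i∈ >>= λ (y , r , y∈) → ∈-join⁻ y∈ >>= λ where
          (inj₁ (i′ , r′ , i′∈)) → pure (subst (_∈ᶜ a) (I₀.injective r′ r) i′∈)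
          (inj₂ (i′ , r′ , _))   → ⊥-elim (disjoint r r′)) ,
        (⊑⁺ λ i∈ → I₀.total _ >>= λ (y , r) → pure (∈-preimage⁺ r (∈-joinˡ r i∈)))
    ; right-join = λ a b →
        (⊑⁺ λ i∈ → ∈-preimage⁻ i∈ >>= λ (y , r , y∈) → ∈-join⁻ y∈ >>= λ where
          (inj₁ (i′ , r′ , _))   → ⊥-elim (disjoint r′ r)
          (inj₂ (i′ , r′ , i′∈)) → pure (subst (_∈ᶜ b) (I₁.injective r′ r) i′∈)) ,
        (⊑⁺ λ i∈ → I₁.total _ >>= λ (y , r) → pure (∈-preimage⁺ r (∈-joinʳ r i∈)))
    ; join-η     = λ e →
        (⊑⁺ λ y∈ → ∈-join⁻ y∈ >>= λ where
          (inj₁ (i , r , i∈)) → ∈-preimage⁻ i∈ >>= λ (y′ , r′ , y′∈) →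
            pure (subst (_∈ᶜ e) (I₀.functional r′ r) y′∈)
          (inj₂ (i , r , i∈)) → ∈-preimage⁻ i∈ >>= λ (y′ , r′ , y′∈) →
            pure (subst (_∈ᶜ e) (I₁.functional r′ r) y′∈)) ,
        (⊑⁺ λ y∈ → cover _ >>= λ where
          (inj₁ (i , r)) → pure (∈-joinˡ r (∈-preimage⁺ r y∈))
          (inj₂ (i , r)) → pure (∈-joinʳ r (∈-preimage⁺ r y∈)))
    }

-- Counting the elements of a set below a bound

data Count (P : ℕ → Set) : ℕ → ℕ → Set where
  none : Count P 0 0
  hit  : ∀ {x i} → P x → Count P x i → Count P (suc x) (suc i)
  miss : ∀ {x i} → ¬ P x → Count P x i → Count P (suc x) i

Unbounded : (ℕ → Set) → Set
Unbounded P = ∀ b → ¬ ¬ (∃ λ x → b ≤ x × P x)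

-- x is the i-th element of P, counting from 0.
Nth : (ℕ → Set) → ℕ → ℕ → Set
Nth P i x = P x × Count P x i

module _ {P : ℕ → Set} where

  count-functional : ∀ {x i j} → Count P x i → Count P x j → i ≡ j
  count-functional none       none       = refl
  count-functional (hit _ c)  (hit _ d)  = cong suc (count-functional c d)
  count-functional (hit p _)  (miss q _) = contradiction p q
  count-functional (miss q _) (hit p _)  = contradiction p q
  count-functional (miss _ c) (miss _ d) = count-functional c d

  count-mono : ∀ {x y i j} → x ≤ y → Count P x i → Count P y j → i ≤ j
  count-mono x≤y c d with m≤n⇒m<n∨m≡n x≤y
  ... | inj₂ refl = ≤-reflexive (count-functional c d)
  count-mono _ c (hit _ d)  | inj₁ (s≤s x≤y) = m≤n⇒m≤1+n (count-mono x≤y c d)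
  count-mono _ c (miss _ d) | inj₁ (s≤s x≤y) = count-mono x≤y c d

  nth-strict : ∀ {x y i} → x < y → Nth P i x → ¬ Nth P i y
  nth-strict x<y (p , c) (_ , d) = <-irrefl refl (count-mono x<y (hit p c) d)

  -- Search upwards from `x`, bounded by the known element `d + x`: skipped numbers are misses, so
  -- the count is still `i` at the first element met.
  next : ∀ d {x i} → Count P x i → P (d + x) → ¬ ¬ (∃ λ y → Nth P i y)
  next zero    c p = pure (_ , p , c)
  next (suc d) {x} c p = ¬¬-excluded-middle {A = P x} >>= λ where
    (yes q) → pure (x , q , c)
    (no ¬q) → next d (miss ¬q c) (subst P (sym (+-suc d x)) p)

  nth-isInjection : Unbounded P → IsInjection (Nth P)
  nth-isInjection unb = record
    { total      = total
    ; functional = λ {_} {y} {y′} m n → functional (<-cmp y y′) m n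
    ; injective  = λ (_ , c) (_ , d) → count-functional c d
    }
    where
    -- Each element is sought from just after the previous one.
    reach : ∀ i → ¬ ¬ (∃ λ x → Count P x i)
    total : ∀ i → ¬ ¬ (∃ λ x → Nth P i x)
    reach zero    = pure (0 , none)
    reach (suc i) = total i >>= λ (x , p , c) → pure (suc x , hit p c)
    total i = reach i >>= λ (x , c) → unb x >>= λ (y , x≤y , p) →
      next (y ∸ x) c (subst P (sym (m∸n+n≡m x≤y)) p)
    functional : ∀ {i y y′} → _ → Nth P i y → Nth P i y′ → y ≡ y′
    functional (tri< lt _ _) m n = contradiction n (nth-strict lt m)
    functional (tri≈ _ eq _) m n = eq
    functional (tri> _ _ gt) m n = contradiction m (nth-strict gt n)

-- The backward direction serves totality alone, which is doubly negated anyway.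
IsInjection-resp : ∀ {G H : ℕ → ℕ → Set} → (∀ {i x} → G i x → H i x) →
                   (∀ {i x} → H i x → ¬ ¬ G i x) → IsInjection H → IsInjection G
IsInjection-resp to from inj = record
  { total      = λ i → total i >>= λ (x , h) → from h >>= λ g → pure (x , g)
  ; functional = λ g g′ → functional (to g) (to g′)
  ; injective  = λ g g′ → injective (to g) (to g′)
  }
  where open IsInjection inj

-- Computable ranges and their enumerations

Holds? : ∀ {k} (a : PR k) xs → Dec (Holds a xs)
Holds? a xs with eval a xs ≟ 0
... | yes a≡0 = no λ (holds a≢0) → a≢0 a≡0
... | no a≢0  = yes (holds a≢0)

¬Holds⇒≡0 : ∀ {k} {a : PR k} {xs} → ¬ Holds a xs → eval a xs ≡ 0
¬Holds⇒≡0 {a = a} {xs} ¬h with eval a xs ≟ 0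
... | yes a≡0 = a≡0
... | no a≢0  = contradiction (holds a≢0) ¬h

-- The range of an unbounded monotone function is decidable: x is settled once
-- the function has passed it.  Values are shifted by one, 0 meaning undefined.
module MonotoneRange (rᵖ : PR 1)
  (r-mono : ∀ {s t} → s ≤ t → eval rᵖ (s ∷ []) ≤ eval rᵖ (t ∷ []))
  (r-unbounded : ∀ b → ¬ ¬ (∃ λ t → b < eval rᵖ (t ∷ [])))
  where

  InRange : ℕ → Set
  InRange x = ∃ λ s → eval rᵖ (s ∷ []) ≡ suc x

  Settled : ℕ → ℕ → Set
  Settled x t = suc x < eval rᵖ (t ∷ [])

  inRangeᵖ : PR 2
  inRangeᵖ = ∑ᵖ (proj (# 1)) (comp rᵖ (proj (# 0) ∷ []) == comp succᵖ (proj (# 1) ∷ []))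

  -- The test has to be right only at settled stages. This makes the notion closed under negation,
  -- so that the range and its complement are handled alike.
  Decides : PR 2 → (ℕ → Set) → Set
  Decides a P = ∀ {x t} → Settled x t →
    (Holds a (x ∷ t ∷ []) → P x) × (P x → Holds a (x ∷ t ∷ []))

  inRange-decides : Decides inRangeᵖ InRange
  inRange-decides {x} {t} settled =
    (λ h → let s , _ , p = ∑⁻ h in s , ==⁻ p) ,
    (λ (s , p) →
      -- From `t` on all values exceed `suc x`, so the stage `s` lies below `t` and the bounded
      -- search meets it.
      ∑⁺ (≰⇒> λ t≤s → <-irrefl (sym p) (<-≤-trans settled (r-mono t≤s))) (==⁺ p))

  not-decides : ∀ {a P} → Decides a P → Decides (not a) (¬_ ∘ P)
  not-decides dec settled =
    (λ h p → not⁻ h (proj₂ (dec settled) p)) , (λ ¬p → not⁺ (¬p ∘ proj₁ (dec settled)))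

  -- not (not a) takes only the values 0 and 1
  tallyᵖ : PR 2 → PR 3
  tallyᵖ a = ∑ᵖ (proj (# 1)) (comp (not (not a)) (proj (# 0) ∷ proj (# 3) ∷ []))

  -- The graph of the increasing enumeration of the set decided by `a`. A stage that settles `x`
  -- settles all smaller numbers too, so the tally is correct there.
  nthᵖ : PR 2 → PR 3
  nthᵖ a = ((comp rᵖ (proj (# 2) ∷ []) ⊖ comp succᵖ (proj (# 1) ∷ [])) ⊗
            comp a (proj (# 1) ∷ proj (# 2) ∷ [])) ⊗
           (tallyᵖ a == proj (# 0))

  module _ {a : PR 2} {P : ℕ → Set} (dec : Decides a P) where

    tally : ℕ → ℕ → ℕ
    tally x t = ∑ x (λ y → eval (not (not a)) (y ∷ t ∷ []))

    eval-tally : ∀ i x t → eval (tallyᵖ a) (i ∷ x ∷ t ∷ []) ≡ tally x t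
    eval-tally i x t = eval-∑ (proj (# 1))
      (comp (not (not a)) (proj (# 0) ∷ proj (# 3) ∷ [])) (i ∷ x ∷ t ∷ [])

    eval-not-not : ∀ {xs} → (Holds a xs → eval (not (not a)) xs ≡ 1) ×
                   (¬ Holds a xs → eval (not (not a)) xs ≡ 0)
    eval-not-not {xs} =
      (λ h → ifzero-≡0 (not a) (num 1) (num 0) xs (ifzero-≢0 a (num 1) (num 0) xs (nonzero h))) ,
      (λ ¬h → ifzero-≢0 (not a) (num 1) (num 0) xs (nonzero (not⁺ ¬h)))

    tally-counts : ∀ {t} x → (∀ {y} → y < x → Settled y t) → Count P x (tally x t)
    tally-counts zero settled = none
    tally-counts {t} (suc x) settled with Holds? a (x ∷ t ∷ [])
    ... | yes h = subst (λ n → Count P (suc x) (n + tally x t)) (sym (proj₁ eval-not-not h))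
      (hit (proj₁ (dec (settled ≤-refl)) h) (tally-counts x (settled ∘ m≤n⇒m≤1+n)))
    ... | no ¬h = subst (λ n → Count P (suc x) (n + tally x t)) (sym (proj₂ eval-not-not ¬h))
      (miss (¬h ∘ proj₂ (dec (settled ≤-refl))) (tally-counts x (settled ∘ m≤n⇒m≤1+n)))

    settled-tally : ∀ {x t} → Settled x t → Count P x (tally x t)
    settled-tally settled = tally-counts _ λ y<x → <-trans (s≤s y<x) settled

    Rel⇒Nth : ∀ {i x} → Rel (nthᵖ a) i x → Nth P i x
    Rel⇒Nth {i} {x} (t , h) =
      let h₁₂ , h₃ = ⊗⁻ h
          h₁ , h₂  = ⊗⁻ h₁₂
          settled  = ⊖⁻ h₁
      in proj₁ (dec settled) (holds (nonzero h₂)) ,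
         subst (Count P x) (trans (sym (eval-tally i x t)) (==⁻ h₃)) (settled-tally settled)

    Nth⇒Rel : ∀ {i x} → Nth P i x → ¬ ¬ Rel (nthᵖ a) i x
    Nth⇒Rel {i} {x} (p , c) = r-unbounded (suc x) >>= λ (t , settled) →
      pure (t , ⊗⁺ (⊗⁺ (⊖⁺ settled) (holds (nonzero (proj₂ (dec settled) p))))
        (==⁺ (trans (eval-tally i x t) (count-functional (settled-tally settled) c))))

    nthᵖ-isInjection : Unbounded P → IsInjection (Rel (nthᵖ a))
    nthᵖ-isInjection unb = IsInjection-resp Rel⇒Nth Nth⇒Rel (nth-isInjection unb)

    nthᵖ-onto : ∀ {x} → P x → ¬ ¬ (∃ λ i → Rel (nthᵖ a) i x)
    nthᵖ-onto {x} p = r-unbounded (suc x) >>= λ (t , settled) →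
      Nth⇒Rel (p , settled-tally settled) >>= λ rel → pure (_ , rel)

  InRange-unbounded : Unbounded InRange
  InRange-unbounded b = r-unbounded b >>= λ (t , b<r) → pure (bound t b<r)
    where
    bound : ∀ t → b < eval rᵖ (t ∷ []) → ∃ λ x → b ≤ x × InRange x
    bound t b<r with eval rᵖ (t ∷ []) in eq
    bound t (s≤s b≤x) | suc x = x , b≤x , t , eq

  module _ (co-unbounded : Unbounded (¬_ ∘ InRange)) where
    private
      outside : Decides (not inRangeᵖ) (¬_ ∘ InRange)
      outside = not-decides inRange-decides

    -- The complement of the range is the left part and the range the right one; both are infinite,
    -- and their increasing enumerations identify them with ℕ.
    range-split : Split
    range-split = FromPartition.split (nthᵖ (not inRangeᵖ)) (nthᵖ inRangeᵖ)
      (nthᵖ-isInjection outside co-unbounded) (nthᵖ-isInjection inRange-decides InRange-unbounded)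
      (λ g h → proj₁ (Rel⇒Nth outside g) (proj₁ (Rel⇒Nth inRange-decides h)))
      (λ y → ¬¬-excluded-middle {A = InRange y} >>= λ where
        (yes p) → nthᵖ-onto inRange-decides p >>= (pure ∘ inj₂)
        (no ¬p) → nthᵖ-onto outside ¬p >>= (pure ∘ inj₁))

    open Split range-split

    right-full : ∀ {e} → (∀ {y} → InRange y → y ∈ᶜ e) → ℕᶜ ⊑ right e
    right-full h = ⊑⁺ λ _ →
      IsInjection.total (nthᵖ-isInjection inRange-decides InRange-unbounded) _ >>= λ (y , g) →
      pure (∈-preimage⁺ g (h (proj₁ (Rel⇒Nth inRange-decides g))))

    right-empty : ∀ {e} → (∀ {y} → InRange y → ¬ (y ∈ᶜ e)) → right e ⊑ ∅ᶜ
    right-empty h = ⊑⁺ λ x∈ → ∈-preimage⁻ x∈ >>= λ (y , g , y∈) →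
      ⊥-elim (h (proj₁ (Rel⇒Nth inRange-decides g)) y∈)

-- The largest x < t that has entered V before stage t, shifted by one, is a
-- monotone function of t.
module Maximum (V : CE) where

  private
    seenᵖ : PR 3
    -- The arguments are the value so far, the candidate and the stage; inside the sum the time of
    -- entry is put in front.
    seenᵖ = ∑ᵖ (proj (# 2)) (comp V (proj (# 2) ∷ proj (# 0) ∷ []))

    below : PR 2
    below = rec zeroᵖ (ifzero seenᵖ (proj (# 0)) (comp succᵖ (proj (# 1) ∷ [])))

  maxᵖ : PR 1
  maxᵖ = comp below (proj (# 0) ∷ proj (# 0) ∷ [])

  Seen : ℕ → ℕ → Set
  Seen x t = ∃ λ s → s < t × Holds V (x ∷ s ∷ [])

  below-skip : ∀ n t → ¬ Holds seenᵖ (eval below (n ∷ t ∷ []) ∷ n ∷ t ∷ []) →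
               eval below (suc n ∷ t ∷ []) ≡ eval below (n ∷ t ∷ [])
  below-skip n t ¬h = ifzero-≡0 seenᵖ (proj (# 0)) (comp succᵖ (proj (# 1) ∷ []))
    (eval below (n ∷ t ∷ []) ∷ n ∷ t ∷ []) (¬Holds⇒≡0 ¬h)

  below-new : ∀ n t → Holds seenᵖ (eval below (n ∷ t ∷ []) ∷ n ∷ t ∷ []) →
              eval below (suc n ∷ t ∷ []) ≡ suc n
  below-new n t h = ifzero-≢0 seenᵖ (proj (# 0)) (comp succᵖ (proj (# 1) ∷ []))
    (eval below (n ∷ t ∷ []) ∷ n ∷ t ∷ []) (nonzero h)

  below-sound : ∀ n {t x} → eval below (n ∷ t ∷ []) ≡ suc x → x < n × Seen x t
  below-sound (suc n) {t} eq with Holds? seenᵖ (eval below (n ∷ t ∷ []) ∷ n ∷ t ∷ [])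
  ... | no ¬h = let x<n , seen = below-sound n (trans (sym (below-skip n t ¬h)) eq)
                in m≤n⇒m≤1+n x<n , seen
  ... | yes h with trans (sym (below-new n t h)) eq
  ...   | refl = let s , s<t , v = ∑⁻ h in ≤-refl , s , s<t , holds (nonzero v)

  below-complete : ∀ n {t x} → x < n → Seen x t → x < eval below (n ∷ t ∷ [])
  below-complete (suc n) {t} {x} (s≤s x≤n) seen@(s , s<t , v)
    with Holds? seenᵖ (eval below (n ∷ t ∷ []) ∷ n ∷ t ∷ [])
  ... | yes h = ≤-trans (s≤s x≤n) (≤-reflexive (sym (below-new n t h)))
  ... | no ¬h with m≤n⇒m<n∨m≡n x≤n
  ...   | inj₁ x<n  = ≤-trans (below-complete n x<n seen) (≤-reflexive (sym (below-skip n t ¬h)))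
  ...   | inj₂ refl = contradiction (∑⁺ s<t (holds (nonzero v))) ¬h

  max-∈ : ∀ {t x} → eval maxᵖ (t ∷ []) ≡ suc x → x ∈ᶜ V
  max-∈ {t} eq = let _ , s , _ , v = below-sound t eq in member (pure (s , v))

  -- The search bound and the stage grow together, so the maximum at `s` is still a candidate at
  -- `t`.
  max-mono : ∀ {s t} → s ≤ t → eval maxᵖ (s ∷ []) ≤ eval maxᵖ (t ∷ [])
  max-mono {s} {t} s≤t with eval maxᵖ (s ∷ []) in eq
  ... | zero  = z≤n
  ... | suc x = let x<s , u , u<s , v = below-sound s eq
                in below-complete t (<-≤-trans x<s s≤t) (u , <-≤-trans u<s s≤t , v)

  max-unbounded : Unbounded (_∈ᶜ V) → ∀ b → ¬ ¬ (∃ λ t → b < eval maxᵖ (t ∷ []))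
  max-unbounded unb b = unb b >>= λ (x , b≤x , x∈) → witness x∈ >>= λ (s , v) →
    -- A stage beyond both `x` and its time of entry `s`.
    pure (suc (x + s) , ≤-<-trans b≤x
      (below-complete (suc (x + s)) (s≤s (m≤m+n x s)) (s , s≤s (m≤n+m s x) , v)))

-- Choosing among the even numbers keeps the complement of the chosen set infinite.

evenᵖ : PR 1
evenᵖ = rec (num 1) (not (proj (# 0)))

Even : ℕ → Set
Even x = Holds evenᵖ (x ∷ [])

even-suc : ∀ {x} → Even x → ¬ Even (suc x)
even-suc {x} (holds p) (holds q) =
  not⁻ {xs = eval evenᵖ (x ∷ []) ∷ x ∷ []} {a = proj (# 0)} (holds q) (holds p)

suc-even : ∀ {x} → ¬ Even x → Even (suc x)
suc-even {x} ¬p = holds (nonzero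
  (not⁺ {xs = eval evenᵖ (x ∷ []) ∷ x ∷ []} {a = proj (# 0)} λ (holds p) → ¬p (holds p)))

even-above : ∀ b → ∃ λ x → b ≤ x × Even x
even-above b with Holds? evenᵖ (b ∷ [])
... | yes p = b , ≤-refl , p
... | no ¬p = suc b , n≤1+n b , suc-even ¬p

odd-above : ∀ b → ∃ λ x → b ≤ x × ¬ Even x
odd-above b with Holds? evenᵖ (b ∷ [])
... | yes p = suc b , n≤1+n b , even-suc p
... | no ¬p = b , ≤-refl , ¬p

-- The right part is an infinite computable subset of `V`, the range of its running maximum; the
-- complement contains all odd numbers.
split-into : ∀ V → Unbounded (_∈ᶜ V) → (∀ {x} → x ∈ᶜ V → Even x) →
  Σ Split λ S → ∀ {e} →
    ((∀ {y} → y ∈ᶜ V → y ∈ᶜ e) → ℕᶜ ⊑ Split.right S e) ×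
    ((∀ {y} → y ∈ᶜ V → ¬ (y ∈ᶜ e)) → Split.right S e ⊑ ∅ᶜ)
split-into V unb even = range-split co , λ {e} →
  (λ h → right-full co {e} λ (t , eq) → h (max-∈ {t} eq)) ,
  (λ h → right-empty co {e} λ (t , eq) → h (max-∈ {t} eq))
  where
  open Maximum V
  open MonotoneRange maxᵖ (λ {s} {t} → max-mono {s} {t}) (max-unbounded unb)
  co : Unbounded (¬_ ∘ InRange)
  co b = let x , b≤x , odd = odd-above b in
    pure (x , b≤x , λ (t , eq) → odd (even (max-∈ {t} eq)))

-- Either `e` misses all even numbers from some `b` on, and these form a set disjoint from `e`, or
-- the even elements of `e` form an infinite c.e. set inside it.
trivialise : ∀ e → ¬ ¬ (Σ Split λ S → Trivial (Split.right S e))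
trivialise e = ¬¬-excluded-middle {A = AvoidsEvens} >>= λ where
    (yes (b , avoid)) → let S , p = split-into (V₀ b) (unb₀ b) (λ x∈ → proj₁ (V₀⁻ b x∈)) in
      pure (S , inj₁ (proj₂ p λ x∈ → let ev , b≤x = V₀⁻ b x∈ in avoid _ b≤x ev))
    (no ¬avoid) → let S , p = split-into V₁ (unb₁ ¬avoid) (λ x∈ → proj₁ (V₁⁻ x∈)) in
      pure (S , inj₂ (proj₁ p λ x∈ → proj₂ (V₁⁻ x∈)))
  where
  AvoidsEvens : Set
  AvoidsEvens = ∃ λ b → ∀ x → b ≤ x → Even x → ¬ (x ∈ᶜ e)

  evenᶜ : CE
  evenᶜ = comp evenᵖ (proj (# 0) ∷ [])

  Even-stable : ∀ {x} → ¬ ¬ Even x → Even x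
  Even-stable {x} m = holds λ eq → m λ p → nonzero p eq

  V₀ : ℕ → CE
  -- The truncated difference of `suc x` and `b` is nonzero exactly when `b ≤ x`.
  V₀ b = evenᶜ ⊗ (comp succᵖ (proj (# 0) ∷ []) ⊖ num b)

  V₀⁻ : ∀ b {x} → x ∈ᶜ V₀ b → Even x × b ≤ x
  V₀⁻ b (member m) =
    Even-stable (m >>= λ (_ , p) → pure (holds (nonzero (proj₁ (⊗⁻ p))))) ,
    ≮⇒≥ λ x<b → m λ (_ , p) → <⇒≱ x<b
      (≤-pred (subst (_< _) (eval-num b _) (⊖⁻ (proj₂ (⊗⁻ p)))))

  unb₀ : ∀ b → Unbounded (_∈ᶜ V₀ b)
  unb₀ b c = let x , b+c≤x , ev = even-above (b + c) in
    pure (x , ≤-trans (m≤n+m c b) b+c≤x , member (pure (0 ,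
      ⊗⁺ (holds (nonzero ev))
         (⊖⁺ (subst (_< suc x) (sym (eval-num b _)) (s≤s (≤-trans (m≤m+n b c) b+c≤x)))))))

  V₁ : CE
  V₁ = evenᶜ ⊗ e

  V₁⁻ : ∀ {x} → x ∈ᶜ V₁ → Even x × x ∈ᶜ e
  V₁⁻ (member m) =
    Even-stable (m >>= λ (_ , p) → pure (holds (nonzero (proj₁ (⊗⁻ p))))) ,
    member (m >>= λ (t , p) → pure (t , proj₂ (⊗⁻ p)))

  unb₁ : ¬ AvoidsEvens → Unbounded (_∈ᶜ V₁)
  unb₁ ¬avoid b k = ¬avoid (b , λ x b≤x ev (member m) → m λ (t , p) →
    k (x , b≤x , member (pure (t , ⊗⁺ (holds (nonzero ev)) p))))

-- Normal forms

-- The right part is shrunk once for each entry; halves that are already trivial stay so by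
-- `right-trivial`.
trivialise-all : ∀ {n} (X : Tuple n) → ¬ ¬ (Σ Split λ S → ∀ i → Trivial (Split.right S (X i)))
trivialise-all {zero} X = trivialise ∅ᶜ >>= λ (S , _) → pure (S , λ ())
trivialise-all {suc n} X =
  trivialise-all (X ∘ F.suc) >>= λ (S , triv) →
  trivialise (Split.right S (X F.zero)) >>= λ (T , triv₀) →
  pure (refine S T , λ { F.zero → triv₀ ; (F.suc i) → right-trivial T (triv i) })

pair-pointwise : ∀ n {R : CE → CE → Set} {X X′ Y Y′ : Tuple n} →
  (∀ i → R (X i) (X′ i)) → (∀ i → R (Y i) (Y′ i)) → ∀ i → R (pair X Y i) (pair X′ Y′ i)
pair-pointwise n x y i with splitAt n i
... | inj₁ a = x a
... | inj₂ b = y b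

-- Finiteness of the coded order

module _ {n : ℕ} {δ : Formula n} {ε ℓt : Formula (n + n)}
         (interp : InfLinOrderInterp n δ ε ℓt) where
  open InfLinOrderInterp interp

  -- An automorphism of finite order of a linear order is trivial.
  involution-fixes : ∀ {σ} → Involution σ → ∀ X → Sat δ X →
                     Sat δ (σ ∘ X) × Sat ε (pair X (σ ∘ X))
  involution-fixes {σ} inv X dX = dY , Sat-stable ε (λ-total X Y dX dY >>= λ where
      (inj₁ p) → pure (λ-antisym X Y dX dY p (flip-sides p))
      (inj₂ p) → pure (λ-antisym X Y dX dY (flip-sides⁻ p) p))
    where
    open Involution inv
    Y = σ ∘ X
    dY = ≅⇒Sat δ ≤-refl (≅-image (depth δ) λ _ → ≈-refl) dX
    -- `σ` carries (X , σ X) to (σ X , X), so whichever comparison totality supplies, the opposite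
    -- one follows.
    image : pair X Y ≅[ depth ℓt ] pair Y X
    image = ≅-image (depth ℓt)
      (pair-pointwise n {R = λ a b → b ≈ σ a} (λ _ → ≈-refl) (λ i → ≈-sym (invol (X i))))
    flip-sides : Sat ℓt (pair X Y) → Sat ℓt (pair Y X)
    flip-sides = ≅⇒Sat ℓt ≤-refl image
    flip-sides⁻ : Sat ℓt (pair Y X) → Sat ℓt (pair X Y)
    flip-sides⁻ = ≅⇒Sat ℓt ≤-refl (≅-sym (depth ℓt) image)

  module _ (S : Split) where
    open Split S

    -- Including ∅ and ℕ lets the type tell apart trivial right halves.
    halves : Tuple n → Tuple (2 + (n + n))
    halves X = extend ∅ᶜ (extend ℕᶜ (pair (right ∘ X) (left ∘ X)))

    -- X is equivalent to its exchange. Replacing that by the exchange of Y keeps all left halves,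
    -- since the right halves of X and Y agree, and keeps the type of the right halves. The exchange
    -- of Y is equivalent to Y.
    same-type⇒ε : ∀ {X Y} → Sat δ X → Sat δ Y → (∀ i → right (X i) ≈ right (Y i)) →
                  halves X ≅[ depth ε ] halves Y → Sat ε (pair X Y)
    same-type⇒ε {X} {Y} dX dY r p =
      let dσY , εYσY = involution-fixes exchange-involution Y dY
          εXσX = proj₂ (involution-fixes exchange-involution X dX)
          εXσY = ≅⇒Sat ε ≤-refl
            (≅-join (depth ε) {A = pair X (exchange ∘ X)} {pair X (exchange ∘ Y)}
              -- Skips the entries ∅ and ℕ of `halves`.
              (F.suc ∘ F.suc)
              (pair-pointwise n {R = λ a b → left a ≈ left b} (λ _ → ≈-refl)
                λ i → ≈-trans (left-exchange _) (≈-trans (r i) (≈-sym (left-exchange _))))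
              (pair-pointwise n {R = λ a b → right a ≈ b} (λ _ → ≈-refl) λ i → right-exchange _)
              (pair-pointwise n {R = λ a b → right a ≈ b} r λ i → right-exchange _)
              p)
            εXσX
      in ε-trans X (exchange ∘ Y) Y dX dσY dY εXσY (ε-sym Y (exchange ∘ Y) dY dσY εYσY)

    halves-right : ∀ X i → halves X (F.suc (F.suc (i F.↑ˡ n))) ≡ right (X i)
    halves-right X i = cong [ right ∘ X , left ∘ X ] (splitAt-↑ˡ n i n)

    same-right : ∀ {X Y} → SameOrder (halves X) (halves Y) →
                 ∀ i → Trivial (right (X i)) → right (X i) ≈ right (Y i)
    same-right {X} {Y} o i
      with o (F.suc (F.suc (i F.↑ˡ n))) F.zero | o (F.suc F.zero) (F.suc (F.suc (i F.↑ˡ n)))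
    ... | below , _ | above , _ rewrite halves-right X i | halves-right Y i = λ where
      (inj₁ t) → ⊑-trans t ∅-least , ⊑-trans (below t) ∅-least
      (inj₂ t) → ⊑-trans ℕ-greatest (above t) , ⊑-trans ℕ-greatest t

    -- For `finite-reps`: as `B` runs through a finite list of types these are finitely many
    -- predicates on D, and tuples sharing one are equivalent by `Normal-ε`.
    record Normal (X : Tuple n) (B : Tuple (2 + (n + n))) : Set where
      constructor normal
      field
        form    : Tuple n
        form∈δ  : Sat δ form
        X-ε     : Sat ε (pair X form)
        trivial : ∀ i → Trivial (right (form i))
        type    : halves form ≅[ depth ε ] B

    -- `S` stays the same for all X. The split `T` of its left part depends on X and makes the left
    -- halves trivial on one piece, which `transpose` moves to the right part of `S`.
    normalise : ∀ X → Sat δ X → ¬ ¬ (Σ (Tuple n) λ Y →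
                Sat δ Y × Sat ε (pair X Y) × (∀ i → Trivial (right (Y i))))
    normalise X dX = trivialise-all (left ∘ X) >>= λ (T , triv) →
      let open Transposition S T
          dY , e = involution-fixes transpose-involution X dX
      in pure (transpose ∘ X , dY , e , λ i → Trivial-resp (≈-sym (right-transpose (X i))) (triv i))

    Normal-ε : ∀ {X Y B} → Sat δ X → Sat δ Y → Normal X B → Normal Y B → Sat ε (pair X Y)
    Normal-ε {X} {Y} dX dY (normal X* dX* e t p) (normal Y* dY* e′ t′ p′) =
      ε-trans X X* Y dX dX* dY e (ε-trans X* Y* Y dX* dY* dY
        (same-type⇒ε dX* dY* (λ i → same-right (≅⇒SameOrder (depth ε) q) i (t i)) q)
        (ε-sym Y Y* dY dY* e′))
      where q = ≅-trans (depth ε) p (≅-sym (depth ε) p′)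

    not-infinite : ⊥
    not-infinite = (finite-types (depth ε) _ >>= λ (Bs , rep) →
      finite-reps (λ B X → Normal X B) Bs (Sat δ) >>= λ (L , all , reps) →
      λ _ → infinite L all λ X dX →
        reps X dX >>= λ any →
        normalise X dX >>= λ (X* , dX* , e , t) →
        rep (halves X*) >>= λ anyB →
        let (B , B∈ , p) = find anyB
            N = normal X* dX* e t p
        -- The representative that agrees with X on all predicates is also normal for `B`, hence
        -- equivalent to X; so `L` meets every class.
        in pure (any-with (λ dY agree → Normal-ε dX dY N (proj₁ (agree B∈) N)) all any)) id

  no-interpretation : ⊥
  -- Any split serves; `trivialise` supplies one.
  no-interpretation = (trivialise ∅ᶜ >>= λ (S , _) → pure (not-infinite S)) id

theorem4p24 : ¬ (Σ ℕ (λ n → (1 ≤ n) × Σ (Formula n) (λ δ → Σ (Formula (n + n)) (λ ε → Σ (Formula (n + n)) (λ λ' → InfLinOrderInterp n δ ε λ')))))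
theorem4p24 (n , _ , δ , ε , ℓt , interp) = no-interpretation interp
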